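{- Let $T$ be a finite tree of order at least two. Then $T$ is an SR-graph if and only if $T$ contains neither weak edges nor strong edges.
   Context: $\gamma(G)$ denotes the domination number of a finite simple graph $G$, and $\Gamma(G)$ the set of all minimum dominating sets of $G$. For an edge $e=uv$ of $G$, $G-e$ is the graph obtained by deleting $e$, and $G_e$ is the graph obtained by subdividing $e$: delete $e$, add a new vertex $w$ and the edges $uw$ and $wv$. A finite connected simple graph $G$ of order at least two is an SR-graph (sub-removable graph) if $\gamma(G-e)=\gamma(G_e)$ for every edge $e$ of $G$. For $D\subseteq V(G)$ and $u\in D$, the external private neighborhood of $u$ with respect to $D$ is $EPN(u,D)=N_G(u)\setminus N_G[D\setminus\{u\}]$, where $N_G(u)$ is the set of neighbors of $u$ and $N_G[X]$ is the set of vertices that are in $X$ or adjacent to a vertex of $X$. Edges are regarded as two-element sets of vertices; if $|e\cap D|=1$, then $e\cap D$ also denotes the unique end of $e$ in $D$, and $\overline{e\cap D}$ denotes the end of $e$ not in $D$. An edge $e$ of $G$ satisfies Teschner's Condition if for every $D\in\Gamma(G)$ we have $|e\cap D|=1$ and $\overline{e\cap D}\in EPN(e\cap D,D)$. An edge $e$ of a tree $T$ is a weak edge if $e\cap D=\emptyset$ for every $D\in\Gamma(T)$. It is a strong edge if $e$ satisfies Teschner's Condition and there exists $D\in\Gamma(T)$ such that $EPN(e\cap D,D)=\{\overline{e\cap D}\}$. -}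

module Defs where

open import Data.Empty using (⊥)
open import Data.Fin.Base using (Fin; zero; suc)
open import Data.Fin.Properties using (_≟_; any?; all?)
open import Data.Fin.Subset
  using (Subset; _∈_; _∩_; _∪_; _─_; _-_; ⁅_⁆; ∣_∣; ⊤; Empty)
open import Data.Fin.Subset.Properties using (_∈?_; anySubset?; ∈⊤)
open import Data.List.Base using (List; _∷_; _∷ʳ_; length)
open import Data.List.Relation.Unary.Linked using (Linked)
open import Data.List.Relation.Unary.Unique.Propositional using (Unique)
open import Data.Nat.Base using (ℕ; suc; _≤_; _<_)
open import Data.Nat.Induction using (<-wellFounded)
open import Data.Nat.Properties using (_<?_; ≮⇒≥)
open import Data.Product.Base using (∃; ∃₂; _×_; _,_; proj₁)
open import Data.Sum.Base using (_⊎_; inj₁; inj₂)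
open import Induction.WellFounded using (Acc; acc)
open import Level using (0ℓ)
open import Relation.Binary.Construct.Closure.ReflexiveTransitive using (Star)
open import Relation.Binary.Core using (Rel)
open import Relation.Binary.Definitions using (Decidable; Symmetric; Irreflexive)
open import Relation.Binary.PropositionalEquality.Core using (_≡_; refl)
open import Relation.Nullary.Decidable using (Dec; yes; no; _×-dec_; _⊎-dec_; ¬?)
open import Relation.Nullary.Negation.Core using (¬_)
open import Relation.Unary using (Pred; ｛_｝; _≐_; _∖_)

record Graph (n : ℕ) : Set₁ where
  infix 4 _~_ _~?_
  field
    _~_    : Rel (Fin n) 0ℓ
    _~?_   : Decidable _~_
    sym    : Symmetric _~_
    irrefl : Irreflexive _≡_ _~_

record Edge {n : ℕ} (G : Graph n) : Set where
  constructor edge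
  open Graph G
  field
    {u v} : Fin n
    u~v   : u ~ v

-- Edges are stored with an orientation; everything below depends on an edge
-- only through its two-element set of ends, or symmetrically through Joins.
ends : ∀ {n} {G : Graph n} → Edge G → Subset n
ends e = ⁅ Edge.u e ⁆ ∪ ⁅ Edge.v e ⁆

Joins : ∀ {n} {G : Graph n} → Edge G → Rel (Fin n) 0ℓ
Joins e x y = (x ≡ u × y ≡ v) ⊎ (x ≡ v × y ≡ u)
  where open Edge e

joins? : ∀ {n} {G : Graph n} (e : Edge G) → Decidable (Joins e)
joins? e x y = (x ≟ u ×-dec y ≟ v) ⊎-dec (x ≟ v ×-dec y ≟ u)
  where open Edge e

joins-sym : ∀ {n} {G : Graph n} (e : Edge G) → Symmetric (Joins e)
joins-sym e (inj₁ (p , q)) = inj₂ (q , p)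
joins-sym e (inj₂ (p , q)) = inj₁ (q , p)

deleteEdge : ∀ {n} (G : Graph n) → Edge G → Graph n
deleteEdge G e = record
  { _~_    = λ x y → x ~ y × ¬ Joins e x y
  ; _~?_   = λ x y → x ~? y ×-dec ¬? (joins? e x y)
  ; sym    = λ (x~y , ¬j) → sym x~y , λ j → ¬j (joins-sym e j)
  ; irrefl = λ x≡y (x~y , _) → irrefl x≡y x~y
  }
  where open Graph G

-- The new vertex is zero; an old vertex x becomes suc x.
subdivideEdge : ∀ {n} (G : Graph n) → Edge G → Graph (suc n)
subdivideEdge {n} G e = record
  { _~_    = Adj
  ; _~?_   = adj?
  ; sym    = λ {x} {y} → adj-sym x y
  ; irrefl = λ {x} {y} → adj-irrefl x y
  }
  where
  open Edge e
  module G-e = Graph (deleteEdge G e)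

  Adj : Rel (Fin (suc n)) 0ℓ
  Adj zero    zero    = ⊥
  Adj zero    (suc y) = y ≡ u ⊎ y ≡ v
  Adj (suc x) zero    = x ≡ u ⊎ x ≡ v
  Adj (suc x) (suc y) = x G-e.~ y

  adj? : Decidable Adj
  adj? zero    zero    = no λ ()
  adj? zero    (suc y) = y ≟ u ⊎-dec y ≟ v
  adj? (suc x) zero    = x ≟ u ⊎-dec x ≟ v
  adj? (suc x) (suc y) = x G-e.~? y

  adj-sym : ∀ x y → Adj x y → Adj y x
  adj-sym zero    (suc y) p = p
  adj-sym (suc x) zero    p = p
  adj-sym (suc x) (suc y) p = G-e.sym p

  adj-irrefl : ∀ x y → x ≡ y → ¬ Adj x y
  adj-irrefl (suc x) (suc .x) refl p = G-e.irrefl refl p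

module _ {n : ℕ} (G : Graph n) where
  open Graph G

  Connected : Set
  Connected = ∀ x y → Star _~_ x y

  record Cycle : Set where
    field
      start    : Fin n
      rest     : List (Fin n)
      long     : 2 ≤ length rest
      distinct : Unique (start ∷ rest)
      closed   : Linked _~_ (start ∷ (rest ∷ʳ start))

  IsTree : Set
  IsTree = Connected × ¬ Cycle

  N : Fin n → Pred (Fin n) 0ℓ
  N x y = x ~ y

  N[_] : Subset n → Pred (Fin n) 0ℓ
  N[ X ] y = y ∈ X ⊎ ∃ λ x → x ∈ X × x ~ y

  EPN : Fin n → Subset n → Pred (Fin n) 0ℓ
  EPN x D = N x ∖ N[ D - x ]

  Dominating : Pred (Subset n) 0ℓ
  Dominating D = ∀ y → N[ D ] y

  dominating? : ∀ D → Dec (Dominating D)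
  dominating? D = all? λ y → y ∈? D ⊎-dec any? λ x → x ∈? D ×-dec x ~? y

  Γ : Pred (Subset n) 0ℓ
  Γ D = Dominating D × (∀ D′ → Dominating D′ → ∣ D ∣ ≤ ∣ D′ ∣)

  Γ-nonempty : ∃ Γ
  Γ-nonempty = shrink ⊤ (λ _ → inj₁ ∈⊤) (<-wellFounded _)
    where
    shrink : ∀ D → Dominating D → Acc _<_ ∣ D ∣ → ∃ Γ
    shrink D dom (acc rec)
      with anySubset? (λ D′ → dominating? D′ ×-dec ∣ D′ ∣ <? ∣ D ∣)
    ... | yes (D′ , dom′ , D′<D) = shrink D′ dom′ (rec D′<D)
    ... | no  none = D , dom , λ D′ dom′ → ≮⇒≥ λ lt → none (D′ , dom′ , lt)

  γ : ℕ
  γ = ∣ proj₁ Γ-nonempty ∣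

IsSR : ∀ {n} → Graph n → Set
IsSR {n} G =
  Connected G × 2 ≤ n ×
  (∀ (e : Edge G) → γ (deleteEdge G e) ≡ γ (subdivideEdge G e))

module _ {n : ℕ} {G : Graph n} (e : Edge G) where

  -- x is the unique end of e in D, and y is the unique end of e outside D.
  Splits : Subset n → Rel (Fin n) 0ℓ
  Splits D x y = ends e ∩ D ≡ ⁅ x ⁆ × ends e ─ D ≡ ⁅ y ⁆

  -- When ∣ ends e ∩ D ∣ ≡ 1 there is exactly one pair x, y with Splits D x y.
  Teschner : Set
  Teschner = ∀ D → Γ G D →
    ∣ ends e ∩ D ∣ ≡ 1 × ∃₂ λ x y → Splits D x y × EPN G x D y

  Weak : Set
  Weak = ∀ D → Γ G D → Empty (ends e ∩ D)

  Strong : Set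
  Strong = Teschner ×
    ∃ λ D → Γ G D × ∃₂ λ x y → Splits D x y × EPN G x D ≐ ｛ y ｝

{-# OPTIONS --safe #-}
-- For every graph both γ(G − e) and γ(G_e) lie in {γ(G), γ(G) + 1}.  The case
-- γ(G_e) < γ(G − e) characterises strong edges in any graph, by exchanging the
-- new vertex of G_e for an end of e.  Weak edges satisfy γ(G − e) < γ(G_e) in
-- any graph; for the converse let e = ab be a bridge with sides C ∋ a and
-- C′ ∋ b, let D₁ be a minimum dominating set of G that dominates G − e and D₂
-- one that contains a.  Then (C ∩ D₂) ∪ (C′ ∩ D₁) and
-- (C ∩ D₁) ∪ (C′ ∩ D₂) ∪ {b} both dominate G − e and contain an end of e, so
-- both dominate G_e; their sizes sum to at most 2γ(G) + 1, so one of them shows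
-- γ(G_e) ≤ γ(G).
module Submission where

open import Defs
open import Data.Empty using (⊥-elim)
open import Data.Fin.Base using (Fin; zero; suc)
open import Data.Fin.Properties using (_≟_; any?)
open import Data.Fin.Subset
  using (Subset; inside; outside; _∈_; _∉_; _∩_; _∪_; _─_; _-_; ∁; ⁅_⁆; ∣_∣)
open import Data.Fin.Subset.Properties
open import Data.List.Base using (List; []; _∷_; last)
open import Data.List.Membership.DecPropositional using () renaming (_∈?_ to ∈-dec)
import Data.List.Membership.Propositional as List
open import Data.List.Relation.Unary.All.Properties using (¬Any⇒All¬)
open import Data.List.Relation.Unary.AllPairs using ([]; _∷_)
open import Data.List.Relation.Unary.All using ([])
open import Data.List.Relation.Unary.Any using (here; there)
open import Data.List.Relation.Unary.Linked as Linked using (Linked; [-]; _∷_)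
open import Data.List.Relation.Unary.Linked.Properties using (++⁺)
open import Data.List.Relation.Unary.Unique.Propositional using (Unique)
open import Data.Maybe.Base using (just)
open import Data.Maybe.Relation.Binary.Connected using (just) renaming (Connected to Adjoins)
open import Data.Nat.Base using (ℕ; suc; _+_; _≤_; _<_; z≤n; s≤s)
open import Data.Nat.Properties
  using (+-suc; +-comm; +-mono-≤; m≤n⇒m≤1+n; ≤-refl; ≤-trans;
         ≤-antisym; <⇒≱; ≰⇒>; _≤?_; module ≤-Reasoning)
open import Data.Product.Base using (∃; ∃₂; _×_; _,_; proj₁; proj₂)
open import Data.Sum.Base using (_⊎_; inj₁; inj₂; swap)
open import Data.Vec.Base using ([]; _∷_; here; there)
open import Function.Base using (_∘_; id)
open import Function.Bundles using (_⇔_; mk⇔)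
open import Level using (0ℓ)
open import Relation.Binary.Construct.Closure.ReflexiveTransitive
  using (Star; ε; _◅_; _◅◅_; reverse)
open import Relation.Binary.PropositionalEquality.Core
  using (_≡_; _≢_; refl; sym; trans; cong; subst)
open import Relation.Nullary.Decidable
  using (Dec; yes; no; _×-dec_; _⊎-dec_; decidable-stable)
open import Relation.Nullary.Negation.Core using (¬_; contradiction)
open import Relation.Unary using (Pred)

-- Finite subsets: differences, sizes of unions, splicing.

x∈p─q⇒x∉q : ∀ {n} {x : Fin n} (p q : Subset n) → x ∈ p ─ q → x ∉ q
x∈p─q⇒x∉q (_ ∷ p) (inside  ∷ q) (there x∈) (there x∈q) = x∈p─q⇒x∉q p q x∈ x∈q
x∈p─q⇒x∉q (_ ∷ p) (outside ∷ q) (there x∈) (there x∈q) = x∈p─q⇒x∉q p q x∈ x∈q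

x∉p-x : ∀ {n} {x : Fin n} (p : Subset n) → x ∉ p - x
x∉p-x {x = x} p x∈ = x∈p─q⇒x∉q p ⁅ x ⁆ x∈ (x∈⁅x⁆ x)

∣p∪q∣≤∣p∣+∣q∣ : ∀ {n} (p q : Subset n) → ∣ p ∪ q ∣ ≤ ∣ p ∣ + ∣ q ∣
∣p∪q∣≤∣p∣+∣q∣ []            []            = z≤n
∣p∪q∣≤∣p∣+∣q∣ (inside  ∷ p) (inside  ∷ q)
  rewrite +-suc ∣ p ∣ ∣ q ∣ = s≤s (m≤n⇒m≤1+n (∣p∪q∣≤∣p∣+∣q∣ p q))
∣p∪q∣≤∣p∣+∣q∣ (inside  ∷ p) (outside ∷ q) = s≤s (∣p∪q∣≤∣p∣+∣q∣ p q)
∣p∪q∣≤∣p∣+∣q∣ (outside ∷ p) (inside  ∷ q)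
  rewrite +-suc ∣ p ∣ ∣ q ∣ = s≤s (∣p∪q∣≤∣p∣+∣q∣ p q)
∣p∪q∣≤∣p∣+∣q∣ (outside ∷ p) (outside ∷ q) = ∣p∪q∣≤∣p∣+∣q∣ p q

∣p∪⁅x⁆∣≤1+∣p∣ : ∀ {n} (p : Subset n) x → ∣ p ∪ ⁅ x ⁆ ∣ ≤ suc ∣ p ∣
∣p∪⁅x⁆∣≤1+∣p∣ p x = begin
  ∣ p ∪ ⁅ x ⁆ ∣       ≤⟨ ∣p∪q∣≤∣p∣+∣q∣ p ⁅ x ⁆ ⟩
  ∣ p ∣ + ∣ ⁅ x ⁆ ∣   ≡⟨ cong (∣ p ∣ +_) (∣⁅x⁆∣≡1 x) ⟩
  ∣ p ∣ + 1           ≡⟨ +-comm ∣ p ∣ 1 ⟩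
  suc ∣ p ∣           ∎
  where open ≤-Reasoning

x∈p∪⁅x⁆ : ∀ {n} (p : Subset n) x → x ∈ p ∪ ⁅ x ⁆
x∈p∪⁅x⁆ p x = q⊆p∪q p ⁅ x ⁆ (x∈⁅x⁆ x)

-- Glues two dominating sets along a bridge, with `c` as one side of it.
splice : ∀ {n} (c p q : Subset n) → Subset n
splice c p q = (c ∩ p) ∪ (∁ c ∩ q)

splice⁺ˡ : ∀ {n} {c p q : Subset n} {x} → x ∈ c → x ∈ p → x ∈ splice c p q
splice⁺ˡ x∈c x∈p = x∈p∪q⁺ (inj₁ (x∈p∩q⁺ (x∈c , x∈p)))

splice⁺ʳ : ∀ {n} {c p q : Subset n} {x} → x ∉ c → x ∈ q → x ∈ splice c p q
splice⁺ʳ x∉c x∈q = x∈p∪q⁺ (inj₂ (x∈p∩q⁺ (x∉p⇒x∈∁p x∉c , x∈q)))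

-- At each vertex the two splices only swap the roles of `p` and `q`, so the multiplicities add up
-- to the same total.
∣splice∣+∣splice∣ : ∀ {n} (c p q : Subset n) →
  ∣ splice c p q ∣ + ∣ splice c q p ∣ ≡ ∣ p ∣ + ∣ q ∣
∣splice∣+∣splice∣ [] [] [] = refl
∣splice∣+∣splice∣ (inside  ∷ c) (inside  ∷ p) (inside  ∷ q)
  rewrite +-suc ∣ splice c p q ∣ ∣ splice c q p ∣ | +-suc ∣ p ∣ ∣ q ∣ =
  cong (2 +_) (∣splice∣+∣splice∣ c p q)
∣splice∣+∣splice∣ (inside  ∷ c) (inside  ∷ p) (outside ∷ q) = cong suc (∣splice∣+∣splice∣ c p q)
∣splice∣+∣splice∣ (inside  ∷ c) (outside ∷ p) (inside  ∷ q)
  rewrite +-suc ∣ splice c p q ∣ ∣ splice c q p ∣ | +-suc ∣ p ∣ ∣ q ∣ = cong suc (∣splice∣+∣splice∣ c p q)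
∣splice∣+∣splice∣ (inside  ∷ c) (outside ∷ p) (outside ∷ q) = ∣splice∣+∣splice∣ c p q
∣splice∣+∣splice∣ (outside ∷ c) (inside  ∷ p) (inside  ∷ q)
  rewrite +-suc ∣ splice c p q ∣ ∣ splice c q p ∣ | +-suc ∣ p ∣ ∣ q ∣ =
  cong (2 +_) (∣splice∣+∣splice∣ c p q)
∣splice∣+∣splice∣ (outside ∷ c) (inside  ∷ p) (outside ∷ q)
  rewrite +-suc ∣ splice c p q ∣ ∣ splice c q p ∣ = cong suc (∣splice∣+∣splice∣ c p q)
∣splice∣+∣splice∣ (outside ∷ c) (outside ∷ p) (inside  ∷ q)
  rewrite +-suc ∣ p ∣ ∣ q ∣ = cong suc (∣splice∣+∣splice∣ c p q)
∣splice∣+∣splice∣ (outside ∷ c) (outside ∷ p) (outside ∷ q) = ∣splice∣+∣splice∣ c p q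

-- `C` records which disjunct `f` returns; a pointwise choice between two properties thus becomes a
-- genuine subset, with decidable membership.
separate : ∀ {n} {P Q : Pred (Fin n) 0ℓ} → (∀ x → P x ⊎ Q x) →
  ∃ λ C → (∀ {x} → x ∈ C → P x) × (∀ {x} → x ∉ C → Q x)
separate {ℕ.zero} _ = [] , (λ ()) , λ { {()} }
separate {suc n} {P} {Q} f with separate (f ∘ suc) | f zero
... | C , C⊆P , ∁C⊆Q | inj₁ p = inside ∷ C ,
  (λ { here → p ; (there x∈C) → C⊆P x∈C }) ,
  λ { {zero} 0∉ → contradiction here 0∉ ; {suc _} x∉ → ∁C⊆Q (x∉ ∘ there) }
... | C , C⊆P , ∁C⊆Q | inj₂ q = outside ∷ C ,
  (λ { (there x∈C) → C⊆P x∈C }) ,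
  λ { {zero} _ → q ; {suc _} x∉ → ∁C⊆Q (x∉ ∘ there) }

-- Bounds by the domination number.

module _ {n : ℕ} (G : Graph n) where

  N[_]? : ∀ X z → Dec (N[_] G X z)
  N[ X ]? z = z ∈? X ⊎-dec any? λ x → x ∈? X ×-dec Graph._~?_ G x z

  γ≤ : ∀ {D} → Dominating G D → γ G ≤ ∣ D ∣
  γ≤ {D} = proj₂ (proj₂ (Γ-nonempty G)) D

  γ-attained : ∃ λ D → Dominating G D × ∣ D ∣ ≤ γ G
  γ-attained = proj₁ (Γ-nonempty G) , proj₁ (proj₂ (Γ-nonempty G)) , ≤-refl

  Γ⇒∣D∣≤γ : ∀ {D} → Γ G D → ∣ D ∣ ≤ γ G
  Γ⇒∣D∣≤γ (_ , least) = least _ (proj₁ (proj₂ (Γ-nonempty G)))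

  ∣D∣≤γ⇒Γ : ∀ {D} → Dominating G D → ∣ D ∣ ≤ γ G → Γ G D
  ∣D∣≤γ⇒Γ dom D≤γ = dom , λ D′ dom′ → ≤-trans D≤γ (γ≤ dom′)

-- An edge and its ends, in either orientation.

module _ {n : ℕ} {G : Graph n} (e : Edge G) where
  open Graph G using (_~_; irrefl) renaming (sym to ~-sym)
  open Edge e

  private
    G−e : Graph n
    G−e = deleteEdge G e

    Gₑ : Graph (suc n)
    Gₑ = subdivideEdge G e

    module G−e = Graph G−e

  uv-joins : Joins e u v
  uv-joins = inj₁ (refl , refl)

  joins⇒~ : ∀ {a b} → Joins e a b → a ~ b
  joins⇒~ (inj₁ (refl , refl)) = u~v
  joins⇒~ (inj₂ (refl , refl)) = ~-sym u~v

  joins⇒≢ : ∀ {a b} → Joins e a b → a ≢ b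
  joins⇒≢ j a≡b = irrefl a≡b (joins⇒~ j)

  joins⇒endˡ : ∀ {a b} → Joins e a b → a ≡ u ⊎ a ≡ v
  joins⇒endˡ (inj₁ (p , _)) = inj₁ p
  joins⇒endˡ (inj₂ (p , _)) = inj₂ p

  end : ∀ {a b z} → Joins e a b → z ≡ u ⊎ z ≡ v → z ≡ a ⊎ z ≡ b
  end (inj₁ (refl , refl)) = id
  end (inj₂ (refl , refl)) = swap

  joins-same : ∀ {a b x y} → Joins e a b → Joins e x y → (x ≡ a × y ≡ b) ⊎ (x ≡ b × y ≡ a)
  joins-same (inj₁ (refl , refl)) k = k
  joins-same (inj₂ (refl , refl)) k = swap k

  deleted-or-kept : ∀ {a b x y} → Joins e a b → x ~ y →
    x G−e.~ y ⊎ (x ≡ a × y ≡ b) ⊎ (x ≡ b × y ≡ a)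
  deleted-or-kept {x = x} {y} j x~y with joins? e x y
  ... | yes k = inj₂ (joins-same j k)
  ... | no ¬k = inj₁ (x~y , ¬k)

  ∈ends⁻ : ∀ {x} → x ∈ ends e → x ≡ u ⊎ x ≡ v
  ∈ends⁻ x∈ with x∈p∪q⁻ ⁅ u ⁆ ⁅ v ⁆ x∈
  ... | inj₁ p = inj₁ (x∈⁅y⁆⇒x≡y u p)
  ... | inj₂ p = inj₂ (x∈⁅y⁆⇒x≡y v p)

  ∈ends⁺ : ∀ {x} → x ≡ u ⊎ x ≡ v → x ∈ ends e
  ∈ends⁺ (inj₁ refl) = p⊆p∪q ⁅ v ⁆ (x∈⁅x⁆ u)
  ∈ends⁺ (inj₂ refl) = q⊆p∪q ⁅ u ⁆ ⁅ v ⁆ (x∈⁅x⁆ v)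

  ends⇒joins : ∀ {x y} → x ≢ y → x ≡ u ⊎ x ≡ v → y ≡ u ⊎ y ≡ v → Joins e x y
  ends⇒joins x≢y (inj₁ p) (inj₂ q) = inj₁ (p , q)
  ends⇒joins x≢y (inj₂ p) (inj₁ q) = inj₂ (p , q)
  ends⇒joins x≢y (inj₁ p) (inj₁ q) = contradiction (trans p (sym q)) x≢y
  ends⇒joins x≢y (inj₂ p) (inj₂ q) = contradiction (trans p (sym q)) x≢y

  splits⁻ : ∀ {D x y} → Splits e D x y → Joins e x y × x ∈ D × y ∉ D
  splits⁻ {D} {x} {y} (∩≡ , ─≡) =
    ends⇒joins x≢y (∈ends⁻ (proj₁ x∈)) (∈ends⁻ y∈ends) , proj₂ x∈ , y∉D
    where
    x∈ : x ∈ ends e × x ∈ D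
    x∈ = x∈p∩q⁻ (ends e) D (subst (x ∈_) (sym ∩≡) (x∈⁅x⁆ x))
    y∈ : y ∈ ends e ─ D
    y∈ = subst (y ∈_) (sym ─≡) (x∈⁅x⁆ y)
    y∈ends : y ∈ ends e
    y∈ends = p─q⊆p (ends e) D y∈
    y∉D : y ∉ D
    y∉D = x∈p─q⇒x∉q (ends e) D y∈
    x≢y : x ≢ y
    x≢y refl = y∉D (proj₂ x∈)

  splits⁺ : ∀ {D a b} → Joins e a b → a ∈ D → b ∉ D → Splits e D a b
  splits⁺ {D} {a} {b} j a∈D b∉D = ⊆-antisym to-a from-a , ⊆-antisym to-b from-b
    where
    to-a : ∀ {z} → z ∈ ends e ∩ D → z ∈ ⁅ a ⁆
    to-a z∈ with x∈p∩q⁻ (ends e) D z∈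
    ... | z∈e , z∈D with end j (∈ends⁻ z∈e)
    ...   | inj₁ refl = x∈⁅x⁆ a
    ...   | inj₂ refl = contradiction z∈D b∉D
    from-a : ∀ {z} → z ∈ ⁅ a ⁆ → z ∈ ends e ∩ D
    from-a z∈ with x∈⁅y⁆⇒x≡y a z∈
    ... | refl = x∈p∩q⁺ (∈ends⁺ (joins⇒endˡ j) , a∈D)
    to-b : ∀ {z} → z ∈ ends e ─ D → z ∈ ⁅ b ⁆
    to-b z∈ with end j (∈ends⁻ (p─q⊆p (ends e) D z∈))
    ... | inj₁ refl = contradiction a∈D (x∈p─q⇒x∉q (ends e) D z∈)
    ... | inj₂ refl = x∈⁅x⁆ b
    from-b : ∀ {z} → z ∈ ⁅ b ⁆ → z ∈ ends e ─ D
    from-b z∈ with x∈⁅y⁆⇒x≡y b z∈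
    ... | refl = x∈p∧x∉q⇒x∈p─q (∈ends⁺ (joins⇒endˡ (joins-sym e j))) b∉D

  -- Domination in `G − e` and Teschner's Condition.

  dominating-undelete : ∀ {D} → Dominating G−e D → Dominating G D
  dominating-undelete dom z with dom z
  ... | inj₁ z∈D = inj₁ z∈D
  ... | inj₂ (s , s∈D , s~z , _) = inj₂ (s , s∈D , s~z)

  -- The two implications say that `D` contains both ends of `e` or neither; in both cases no vertex
  -- outside `D` is dominated across `e`.
  dominating-delete : ∀ {D} → Dominating G D → (u ∈ D → v ∈ D) → (v ∈ D → u ∈ D) →
    Dominating G−e D
  dominating-delete dom u⇒v v⇒u z with dom z
  ... | inj₁ z∈D = inj₁ z∈D
  ... | inj₂ (s , s∈D , s~z) with deleted-or-kept uv-joins s~z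
  ...   | inj₁ s~′z = inj₂ (s , s∈D , s~′z)
  ...   | inj₂ (inj₁ (refl , refl)) = inj₁ (u⇒v s∈D)
  ...   | inj₂ (inj₂ (refl , refl)) = inj₁ (v⇒u s∈D)

  dominating-mono : ∀ {D D′} → (∀ {x} → x ∈ D → x ∈ D′) → Dominating G D → Dominating G D′
  dominating-mono D⊆D′ dom z with dom z
  ... | inj₁ z∈D = inj₁ (D⊆D′ z∈D)
  ... | inj₂ (s , s∈D , s~z) = inj₂ (s , D⊆D′ s∈D , s~z)

  -- A dominator of `b` in `G − e` is not `a`, hence lies in `D - a`, against privacy.
  private⇒¬dominating : ∀ {D a b} → Joins e a b → b ∉ D → EPN G a D b → ¬ Dominating G−e D
  private⇒¬dominating {D} {a} {b} j b∉D (_ , b∉N) dom with dom b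
  ... | inj₁ b∈D = b∉D b∈D
  ... | inj₂ (s , s∈D , s~b , ¬k) =
    b∉N (inj₂ (s , x∈p∧x≢y⇒x∈p-y s∈D (λ { refl → ¬k j }) , s~b))

  -- Only `b` can depend on `e`. If `b` had a second dominator in `D`, that one would survive the
  -- deletion and `D` would dominate `G − e`.
  ¬dominating⇒private : ∀ {D a b} → Joins e a b → b ∉ D → Dominating G D →
    ¬ Dominating G−e D → EPN G a D b
  ¬dominating⇒private {D} {a} {b} j b∉D dom ¬dom = joins⇒~ j , ¬dom ∘ dom′
    where
    dom′ : N[_] G (D - a) b → Dominating G−e D
    dom′ b∈N z with dom z
    ... | inj₁ z∈D = inj₁ z∈D
    ... | inj₂ (s , s∈D , s~z) with deleted-or-kept j s~z
    ...   | inj₁ s~′z = inj₂ (s , s∈D , s~′z)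
    ...   | inj₂ (inj₂ (refl , refl)) = contradiction s∈D b∉D
    ...   | inj₂ (inj₁ (refl , refl)) with b∈N
    ...     | inj₁ b∈ = contradiction (p─q⊆p D ⁅ a ⁆ b∈) b∉D
    ...     | inj₂ (t , t∈ , t~b) with deleted-or-kept j t~b
    ...       | inj₁ t~′b = inj₂ (t , p─q⊆p D ⁅ a ⁆ t∈ , t~′b)
    ...       | inj₂ (inj₁ (refl , _)) = contradiction t∈ (x∉p-x D)
    ...       | inj₂ (inj₂ (refl , _)) = contradiction (p─q⊆p D ⁅ a ⁆ t∈) b∉D

  splits-privately : ∀ {D a b} → Joins e a b → a ∈ D → b ∉ D → Dominating G D →
    ¬ Dominating G−e D → ∣ ends e ∩ D ∣ ≡ 1 × ∃₂ λ x y → Splits e D x y × EPN G x D y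
  splits-privately {a = a} {b} j a∈ b∉ dom ¬dom =
    trans (cong ∣_∣ (proj₁ spl)) (∣⁅x⁆∣≡1 a) , a , b , spl , ¬dominating⇒private j b∉ dom ¬dom
    where spl = splits⁺ j a∈ b∉

  teschner⇒¬dominating : Teschner e → ∀ {D} → Γ G D → ¬ Dominating G−e D
  teschner⇒¬dominating tes {D} ΓD with tes D ΓD
  ... | _ , x , y , spl , priv with splits⁻ spl
  ...   | j , _ , y∉D = private⇒¬dominating j y∉D priv

  -- With the preceding lemma, Teschner's Condition means that no minimum dominating set of `G`
  -- survives the deletion of `e`. A set with both ends or neither always survives, so exactly one
  -- end lies in `D`.
  ¬dominating⇒teschner : (∀ {D} → Γ G D → ¬ Dominating G−e D) → Teschner e
  ¬dominating⇒teschner ¬dom D ΓD@(dom , _) with u ∈? D | v ∈? D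
  ... | yes u∈ | yes v∈ =
    contradiction (dominating-delete dom (λ _ → v∈) (λ _ → u∈)) (¬dom ΓD)
  ... | no u∉ | no v∉ =
    contradiction (dominating-delete dom (⊥-elim ∘ u∉) (⊥-elim ∘ v∉)) (¬dom ΓD)
  ... | yes u∈ | no v∉ = splits-privately uv-joins u∈ v∉ dom (¬dom ΓD)
  ... | no u∉ | yes v∈ = splits-privately (joins-sym e uv-joins) v∈ u∉ dom (¬dom ΓD)

  -- Domination in the subdivided graph, with and without the new vertex.

  -- S together with the new vertex of G_e dominates G_e.
  DominatesRest : Pred (Subset n) 0ℓ
  DominatesRest S = ∀ z → (z ≡ u ⊎ z ≡ v) ⊎ N[_] G−e S z

  subdivided-inside⁺ : ∀ {S} → DominatesRest S → Dominating Gₑ (inside ∷ S)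
  subdivided-inside⁺ rest zero = inj₁ here
  subdivided-inside⁺ rest (suc z) with rest z
  ... | inj₁ z-end = inj₂ (zero , here , z-end)
  ... | inj₂ (inj₁ z∈S) = inj₁ (there z∈S)
  ... | inj₂ (inj₂ (s , s∈S , s~z)) = inj₂ (suc s , there s∈S , s~z)

  subdivided-inside⁻ : ∀ {S} → Dominating Gₑ (inside ∷ S) → DominatesRest S
  subdivided-inside⁻ dom z with dom (suc z)
  ... | inj₁ (there z∈S) = inj₂ (inj₁ z∈S)
  ... | inj₂ (zero , _ , z-end) = inj₁ z-end
  ... | inj₂ (suc s , there s∈S , s~z) = inj₂ (inj₂ (s , s∈S , s~z))

  -- The new vertex has only the ends of `e` as neighbours, hence the demand that one of them be in
  -- `S`.
  subdivided-outside⁺ : ∀ {S a b} → Joins e a b → a ∈ S → Dominating G−e S →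
    Dominating Gₑ (outside ∷ S)
  subdivided-outside⁺ {a = a} j a∈S dom zero = inj₂ (suc a , there a∈S , joins⇒endˡ j)
  subdivided-outside⁺ j a∈S dom (suc z) with dom z
  ... | inj₁ z∈S = inj₁ (there z∈S)
  ... | inj₂ (s , s∈S , s~z) = inj₂ (suc s , there s∈S , s~z)

  subdivided-outside⁻ : ∀ {S} → Dominating Gₑ (outside ∷ S) → Dominating G−e S
  subdivided-outside⁻ dom z with dom (suc z)
  ... | inj₁ (there z∈S) = inj₁ z∈S
  ... | inj₂ (suc s , there s∈S , s~z) = inj₂ (s , s∈S , s~z)

  subdivided-outside-end : ∀ {S} → Dominating Gₑ (outside ∷ S) →
    ∃ λ a → (a ≡ u ⊎ a ≡ v) × a ∈ S
  subdivided-outside-end dom with dom zero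
  ... | inj₂ (suc a , there a∈S , a-end) = a , a-end , a∈S

  -- Only the ends of `e` can be missed by `S` alone, and `a` covers them both through `e`.
  rest-dominating : ∀ {S a b} → Joins e a b → a ∈ S → DominatesRest S → Dominating G S
  rest-dominating {a = a} j a∈S rest z with rest z
  ... | inj₂ (inj₁ z∈S) = inj₁ z∈S
  ... | inj₂ (inj₂ (s , s∈S , s~z , _)) = inj₂ (s , s∈S , s~z)
  ... | inj₁ z-end with end j z-end
  ...   | inj₁ refl = inj₁ a∈S
  ...   | inj₂ refl = inj₂ (a , a∈S , joins⇒~ j)

  rest-mono : ∀ {S S′} → (∀ {x} → x ∈ S → x ∈ S′) → DominatesRest S → DominatesRest S′
  rest-mono S⊆S′ rest z with rest z
  ... | inj₁ z-end = inj₁ z-end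
  ... | inj₂ (inj₁ z∈S) = inj₂ (inj₁ (S⊆S′ z∈S))
  ... | inj₂ (inj₂ (s , s∈S , s~z)) = inj₂ (inj₂ (s , S⊆S′ s∈S , s~z))

  dominating⇒rest : ∀ {D} → Dominating G D → DominatesRest D
  dominating⇒rest dom z with dom z
  ... | inj₁ z∈D = inj₂ (inj₁ z∈D)
  ... | inj₂ (s , s∈D , s~z) with deleted-or-kept uv-joins s~z
  ...   | inj₁ s~′z = inj₂ (inj₂ (s , s∈D , s~′z))
  ...   | inj₂ (inj₁ (_ , refl)) = inj₁ (inj₂ refl)
  ...   | inj₂ (inj₂ (_ , refl)) = inj₁ (inj₁ refl)

  rest∪⁅u⁆-dominating : ∀ {S} → DominatesRest S → Dominating G (S ∪ ⁅ u ⁆)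
  rest∪⁅u⁆-dominating {S} rest =
    rest-dominating uv-joins (x∈p∪⁅x⁆ S u) (rest-mono (p⊆p∪q ⁅ u ⁆) rest)

  -- Both numbers lie between `γ G` and `suc (γ G)`.

  γ≤γ-delete : γ G ≤ γ G−e
  γ≤γ-delete with γ-attained G−e
  ... | D , dom , D≤γ = ≤-trans (γ≤ G (dominating-undelete dom)) D≤γ

  γ≤γ-subdivide : γ G ≤ γ Gₑ
  γ≤γ-subdivide with γ-attained Gₑ
  ... | outside ∷ S , dom , S≤γ =
    ≤-trans (γ≤ G (dominating-undelete (subdivided-outside⁻ dom))) S≤γ
  -- Exchange the new vertex for `u`. The size of `inside ∷ S` computes to `suc ∣ S ∣`, so the
  -- strict bound pays for `u`.
  ... | inside ∷ S , dom , S<γ =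
    ≤-trans (γ≤ G (rest∪⁅u⁆-dominating (subdivided-inside⁻ dom)))
      (≤-trans (∣p∪⁅x⁆∣≤1+∣p∣ S u) S<γ)

  -- If exactly one end is in `D`, adding the other makes the deletion harmless; if neither is, `D`
  -- itself works.
  γ-delete≤1+γ : γ G−e ≤ suc (γ G)
  γ-delete≤1+γ with γ-attained G
  ... | D , dom , D≤γ with u ∈? D
  ...   | yes u∈D = ≤-trans (γ≤ G−e dom′) (≤-trans (∣p∪⁅x⁆∣≤1+∣p∣ D v) (s≤s D≤γ))
    where
    dom′ : Dominating G−e (D ∪ ⁅ v ⁆)
    dom′ = dominating-delete (dominating-mono (p⊆p∪q ⁅ v ⁆) dom)
      (λ _ → x∈p∪⁅x⁆ D v) (λ _ → p⊆p∪q ⁅ v ⁆ u∈D)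
  ...   | no u∉D with v ∈? D
  ...     | yes v∈D = ≤-trans (γ≤ G−e dom′) (≤-trans (∣p∪⁅x⁆∣≤1+∣p∣ D u) (s≤s D≤γ))
    where
    dom′ : Dominating G−e (D ∪ ⁅ u ⁆)
    dom′ = dominating-delete (dominating-mono (p⊆p∪q ⁅ u ⁆) dom)
      (λ _ → p⊆p∪q ⁅ u ⁆ v∈D) (λ _ → x∈p∪⁅x⁆ D u)
  ...     | no v∉D = ≤-trans (γ≤ G−e dom′) (m≤n⇒m≤1+n D≤γ)
    where
    dom′ : Dominating G−e D
    dom′ = dominating-delete dom (⊥-elim ∘ u∉D) (⊥-elim ∘ v∉D)

  γ-subdivide≤1+γ : γ Gₑ ≤ suc (γ G)
  γ-subdivide≤1+γ with γ-attained G
  ... | D , dom , D≤γ =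
    ≤-trans (γ≤ Gₑ (subdivided-inside⁺ (dominating⇒rest dom))) (s≤s D≤γ)

  -- Weak and strong edges in terms of the two numbers.

  weak⇒γ-delete≤γ : Weak e → γ G−e ≤ γ G
  weak⇒γ-delete≤γ weak with γ-attained G
  ... | D , dom , D≤γ =
    ≤-trans (γ≤ G−e (dominating-delete dom (avoid (inj₁ refl)) (avoid (inj₂ refl)))) D≤γ
    where
    avoid : ∀ {x} {A : Set} → x ≡ u ⊎ x ≡ v → x ∈ D → A
    avoid x-end x∈D =
      ⊥-elim (weak D (∣D∣≤γ⇒Γ G dom D≤γ) (_ , x∈p∩q⁺ (∈ends⁺ x-end , x∈D)))

  -- A dominating set of `Gₑ` of size at most `γ G` yields a minimum one of `G` that meets `e`:
  -- either an end already dominates the new vertex, or the new vertex is exchanged for `u`.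
  weak⇒γ-subdivide≰γ : Weak e → ¬ γ Gₑ ≤ γ G
  weak⇒γ-subdivide≰γ weak γₑ≤γ with γ-attained Gₑ
  ... | outside ∷ S , dom , S≤γₑ with subdivided-outside-end dom
  ...   | a , a-end , a∈S =
    weak S (∣D∣≤γ⇒Γ G (dominating-undelete (subdivided-outside⁻ dom)) (≤-trans S≤γₑ γₑ≤γ))
      (a , x∈p∩q⁺ (∈ends⁺ a-end , a∈S))
  weak⇒γ-subdivide≰γ weak γₑ≤γ | inside ∷ S , dom , S<γₑ =
    weak (S ∪ ⁅ u ⁆)
      (∣D∣≤γ⇒Γ G (rest∪⁅u⁆-dominating (subdivided-inside⁻ dom))
        (≤-trans (∣p∪⁅x⁆∣≤1+∣p∣ S u) (≤-trans S<γₑ γₑ≤γ)))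
      (u , x∈p∩q⁺ (∈ends⁺ (inj₁ refl) , x∈p∪⁅x⁆ S u))

  strong⇒γ-delete≰γ : Strong e → ¬ γ G−e ≤ γ G
  strong⇒γ-delete≰γ (tes , _) γ′≤γ with γ-attained G−e
  ... | D , dom , D≤γ′ =
    teschner⇒¬dominating tes (∣D∣≤γ⇒Γ G (dominating-undelete dom) (≤-trans D≤γ′ γ′≤γ)) dom

  -- Exchange `x` for the new vertex, which covers `x` and `y`. Every other neighbour of `x` has a
  -- dominator in `D - x`, since `y` is the only private one.
  strong⇒γ-subdivide≤γ : Strong e → γ Gₑ ≤ γ G
  strong⇒γ-subdivide≤γ (_ , D , ΓD@(dom , _) , x , y , spl , EPN⊆ , _) with splits⁻ spl
  ... | j , x∈D , y∉D =
    ≤-trans (γ≤ Gₑ (subdivided-inside⁺ rest))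
      (≤-trans (x∈p⇒∣p-x∣<∣p∣ x∈D) (Γ⇒∣D∣≤γ G ΓD))
    where
    in-G−e : ∀ {z} → z ≢ x → z ≢ y → N[_] G (D - x) z → N[_] G−e (D - x) z
    in-G−e z≢x z≢y (inj₁ z∈) = inj₁ z∈
    in-G−e z≢x z≢y (inj₂ (s , s∈ , s~z)) with deleted-or-kept j s~z
    ... | inj₁ s~′z = inj₂ (s , s∈ , s~′z)
    ... | inj₂ (inj₁ (_ , z≡y)) = contradiction z≡y z≢y
    ... | inj₂ (inj₂ (_ , z≡x)) = contradiction z≡x z≢x

    rest : DominatesRest (D - x)
    rest z with z ≟ x | z ≟ y
    ... | yes refl | _ = inj₁ (joins⇒endˡ j)
    ... | _ | yes refl = inj₁ (joins⇒endˡ (joins-sym e j))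
    ... | no z≢x | no z≢y with dom z
    ...   | inj₁ z∈D = inj₂ (inj₁ (x∈p∧x≢y⇒x∈p-y z∈D z≢x))
    ...   | inj₂ (s , s∈D , s~z) with s ≟ x
    ...     | no s≢x = inj₂ (in-G−e z≢x z≢y (inj₂ (s , x∈p∧x≢y⇒x∈p-y s∈D s≢x , s~z)))
    ...     | yes refl with N[_]? G (D - x) z
    ...       | yes z∈N = inj₂ (in-G−e z≢x z≢y z∈N)
    ...       | no z∉N = contradiction (sym (EPN⊆ (s~z , z∉N))) z≢y

  -- The chosen minimum dominating set of `Gₑ` must use the new vertex, as otherwise it would
  -- dominate `G − e` too cheaply. Exchanging that vertex for `u` gives the set required of a strong
  -- edge.
  ≤γ⇒strong : ¬ γ G−e ≤ γ G → γ Gₑ ≤ γ G → Strong e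
  ≤γ⇒strong γ′≰γ γₑ≤γ with γ-attained Gₑ
  ... | outside ∷ S , dom , S≤γₑ =
    contradiction (≤-trans (γ≤ G−e (subdivided-outside⁻ dom)) (≤-trans S≤γₑ γₑ≤γ)) γ′≰γ
  ... | inside ∷ S , dom , S<γₑ = tes , D , ΓD , u , v , splits⁺ uv-joins u∈D v∉D ,
    (λ {z} → only-v z) , λ { refl → ¬dominating⇒private uv-joins v∉D (proj₁ ΓD) (¬dom ΓD) }
    where
    D : Subset n
    D = S ∪ ⁅ u ⁆

    rest : DominatesRest S
    rest = subdivided-inside⁻ dom

    S<γ : ∣ S ∣ < γ G
    S<γ = ≤-trans S<γₑ γₑ≤γ

    -- An end in `S` would make `S` dominate `G` with fewer than `γ G` vertices.
    end∉S : ∀ {a b} → Joins e a b → a ∉ S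
    end∉S j a∈S = <⇒≱ S<γ (γ≤ G (rest-dominating j a∈S rest))

    ΓD : Γ G D
    ΓD = ∣D∣≤γ⇒Γ G (rest∪⁅u⁆-dominating rest) (≤-trans (∣p∪⁅x⁆∣≤1+∣p∣ S u) S<γ)

    u∈D : u ∈ D
    u∈D = x∈p∪⁅x⁆ S u

    v∉D : v ∉ D
    v∉D v∈D with x∈p∪q⁻ S ⁅ u ⁆ v∈D
    ... | inj₁ v∈S = end∉S (joins-sym e uv-joins) v∈S
    ... | inj₂ v∈u = joins⇒≢ uv-joins (sym (x∈⁅y⁆⇒x≡y u v∈u))

    ¬dom : ∀ {D} → Γ G D → ¬ Dominating G−e D
    ¬dom ΓD dom′ = γ′≰γ (≤-trans (γ≤ G−e dom′) (Γ⇒∣D∣≤γ G ΓD))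

    tes : Teschner e
    tes = ¬dominating⇒teschner ¬dom

    S⊆D-u : ∀ {s} → s ∈ S → s ∈ D - u
    S⊆D-u s∈S = x∈p∧x≢y⇒x∈p-y (p⊆p∪q ⁅ u ⁆ s∈S) λ { refl → end∉S uv-joins s∈S }

    only-v : ∀ z → EPN G u D z → v ≡ z
    -- `S` already dominates every vertex but the ends of `e`, and `S` avoids `u`; so a neighbour of
    -- `u` other than `v` is not private.
    only-v z (u~z , z∉N) with rest z
    ... | inj₁ (inj₁ refl) = contradiction u~z (irrefl refl)
    ... | inj₁ (inj₂ refl) = refl
    ... | inj₂ (inj₁ z∈S) = contradiction (inj₁ (S⊆D-u z∈S)) z∉N
    ... | inj₂ (inj₂ (s , s∈S , s~z , _)) =
      contradiction (inj₂ (s , S⊆D-u s∈S , s~z)) z∉N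

  -- Exchanging dominating sets across a bridge.

  record Cut (a b : Fin n) : Set where
    field
      C      : Subset n
      a∈C    : a ∈ C
      b∉C    : b ∉ C
      closed : ∀ {x y} → x G−e.~ y → x ∈ C → y ∈ C

    closed∁ : ∀ {x y} → x G−e.~ y → y ∉ C → x ∉ C
    closed∁ x~y y∉C x∈C = y∉C (closed x~y x∈C)

  module _ {a b : Fin n} (j : Joins e a b) (cut : Cut a b) where
    open Cut cut

    -- Since `a` is in `D₂`, restricting `D₂` to `C` loses nothing when `e` goes. On the other side
    -- it can lose only `b`, which is therefore added to the second splice.
    exchange : ∀ {D₁ D₂} → Dominating G−e D₁ → ∣ D₁ ∣ ≤ γ G →
      Dominating G D₂ → ∣ D₂ ∣ ≤ γ G → a ∈ D₂ → γ Gₑ ≤ γ G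
    exchange {D₁} {D₂} dom₁ D₁≤γ dom₂ D₂≤γ a∈D₂ with ∣ splice C D₂ D₁ ∣ ≤? γ G
    ... | yes le = ≤-trans (γ≤ Gₑ (subdivided-outside⁺ j (splice⁺ˡ a∈C a∈D₂) dom)) le
      where
      dom : Dominating G−e (splice C D₂ D₁)
      dom z with z ∈? C
      dom z | no z∉C with dom₁ z
      ... | inj₁ z∈D₁ = inj₁ (splice⁺ʳ z∉C z∈D₁)
      ... | inj₂ (s , s∈D₁ , s~z) = inj₂ (s , splice⁺ʳ (closed∁ s~z z∉C) s∈D₁ , s~z)
      dom z | yes z∈C with dom₂ z
      ... | inj₁ z∈D₂ = inj₁ (splice⁺ˡ z∈C z∈D₂)
      ... | inj₂ (s , s∈D₂ , s~z) with deleted-or-kept j s~z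
      ...   | inj₁ s~′z = inj₂ (s , splice⁺ˡ (closed (G−e.sym s~′z) z∈C) s∈D₂ , s~′z)
      ...   | inj₂ (inj₁ (_ , refl)) = contradiction z∈C b∉C
      ...   | inj₂ (inj₂ (_ , refl)) = inj₁ (splice⁺ˡ a∈C a∈D₂)
    ... | no ≰ = ≤-trans (γ≤ Gₑ (subdivided-outside⁺ (joins-sym e j) (x∈p∪⁅x⁆ _ b) dom))
                   (≤-trans (∣p∪⁅x⁆∣≤1+∣p∣ (splice C D₁ D₂) b) small)
      where
      D : Subset n
      D = splice C D₁ D₂

      small : ∣ D ∣ < γ G
      -- The two splices have total size at most twice `γ G`; the first exceeds `γ G`, so the second
      -- stays below it and leaves room for `b`.
      small = ≰⇒> λ γ≤D → <⇒≱ (+-mono-≤ (≰⇒> ≰) γ≤D) (begin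
        ∣ splice C D₂ D₁ ∣ + ∣ D ∣   ≡⟨ ∣splice∣+∣splice∣ C D₂ D₁ ⟩
        ∣ D₂ ∣ + ∣ D₁ ∣              ≤⟨ +-mono-≤ D₂≤γ D₁≤γ ⟩
        γ G + γ G                    ∎)
        where open ≤-Reasoning

      dom : Dominating G−e (D ∪ ⁅ b ⁆)
      dom z with z ∈? C
      dom z | yes z∈C with dom₁ z
      ... | inj₁ z∈D₁ = inj₁ (p⊆p∪q ⁅ b ⁆ (splice⁺ˡ z∈C z∈D₁))
      ... | inj₂ (s , s∈D₁ , s~z) =
        inj₂ (s , p⊆p∪q ⁅ b ⁆ (splice⁺ˡ (closed (G−e.sym s~z) z∈C) s∈D₁) , s~z)
      dom z | no z∉C with dom₂ z
      ... | inj₁ z∈D₂ = inj₁ (p⊆p∪q ⁅ b ⁆ (splice⁺ʳ z∉C z∈D₂))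
      ... | inj₂ (s , s∈D₂ , s~z) with deleted-or-kept j s~z
      ...   | inj₁ s~′z = inj₂ (s , p⊆p∪q ⁅ b ⁆ (splice⁺ʳ (closed∁ s~′z z∉C) s∈D₂) , s~′z)
      ...   | inj₂ (inj₁ (_ , refl)) = inj₁ (x∈p∪⁅x⁆ D b)
      ...   | inj₂ (inj₂ (_ , refl)) = contradiction a∈C z∉C

  -- Cuts are supplied for both orientations because either end may be the one that `D` contains.
  ≤γ⇒weak : (∀ {a b} → Joins e a b → Cut a b) → γ G−e ≤ γ G → ¬ γ Gₑ ≤ γ G → Weak e
  ≤γ⇒weak cut γ′≤γ γₑ≰γ D ΓD (x , x∈) with x∈p∩q⁻ (ends e) D x∈ | γ-attained G−e
  ... | x∈e , x∈D | D₁ , dom₁ , D₁≤γ′ = by-end (∈ends⁻ x∈e)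
    where
    absurd : ∀ {a b} → Joins e a b → ¬ a ∈ D
    absurd j a∈D =
      γₑ≰γ (exchange j (cut j) dom₁ (≤-trans D₁≤γ′ γ′≤γ) (proj₁ ΓD) (Γ⇒∣D∣≤γ G ΓD) a∈D)
    by-end : ¬ (x ≡ u ⊎ x ≡ v)
    by-end (inj₁ refl) = absurd uv-joins x∈D
    by-end (inj₂ refl) = absurd (joins-sym e uv-joins) x∈D

  -- Every edge of a tree is a bridge.

  SimplePath : Fin n → Fin n → List (Fin n) → Set
  SimplePath a b xs =
    Unique (a ∷ xs) × Linked G−e._~_ (a ∷ xs) × last (a ∷ xs) ≡ just b

  suffix : ∀ {a b c xs} → SimplePath a b xs → c List.∈ a ∷ xs → ∃ (SimplePath c b)
  suffix {xs = xs} path (here refl) = xs , path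
  suffix {xs = _ ∷ _} (_ ∷ uniq , _ ∷ linked , end-b) (there c∈) =
    suffix (uniq , linked , end-b) c∈

  -- Loop erasure: when the start recurs on the path already found, keep only the part from that
  -- recurrence on.
  simplePath : ∀ {a b} → Star G−e._~_ a b → ∃ (SimplePath a b)
  simplePath ε = [] , [] ∷ [] , [-] , refl
  simplePath {a} (_◅_ {j = c} a~c walk) with simplePath walk
  ... | xs , path@(uniq , linked , end-b) with ∈-dec _≟_ a (c ∷ xs)
  ...   | yes a∈ = suffix path a∈
  ...   | no a∉ = c ∷ xs , ¬Any⇒All¬ _ a∉ ∷ uniq , a~c ∷ linked , end-b

  detour⇒cycle : ∀ {a b} → Joins e a b → Star G−e._~_ a b → Cycle G
  detour⇒cycle {a} {b} j walk with simplePath walk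
  ... | [] , _ , _ , refl = contradiction refl (joins⇒≢ j)
  -- A path of one step would be `e` itself, so the remaining paths are long enough for `Cycle`.
  ... | _ ∷ [] , _ , (_ , ¬j) ∷ _ , refl = contradiction j ¬j
  ... | xs@(_ ∷ _ ∷ _) , uniq , linked , end-b = record
    { start    = a
    ; rest     = xs
    ; long     = s≤s (s≤s z≤n)
    ; distinct = uniq
    ; closed   = ++⁺ (Linked.map proj₁ linked)
        (subst (λ l → Adjoins _~_ l (just a)) (sym end-b) (just (~-sym (joins⇒~ j)))) [-]
    }

  -- Stop the walk just before it first crosses `e`: it then stands at an end of `e`.
  reaches-end : ∀ {a b x} → Joins e a b → Star _~_ x a → Star G−e._~_ x a ⊎ Star G−e._~_ x b
  reaches-end j ε = inj₁ ε
  reaches-end j (x~y ◅ walk) with deleted-or-kept j x~y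
  ... | inj₂ (inj₁ (refl , _)) = inj₁ ε
  ... | inj₂ (inj₂ (refl , _)) = inj₂ ε
  ... | inj₁ x~′y with reaches-end j walk
  ...   | inj₁ w = inj₁ (x~′y ◅ w)
  ...   | inj₂ w = inj₂ (x~′y ◅ w)

  -- A vertex that reaches both ends in `G − e` would give a detour around `e`, hence a cycle. So
  -- the side chosen for each vertex is forced, and adjacent vertices get the same side.
  tree⇒cut : IsTree G → ∀ {a b} → Joins e a b → Cut a b
  tree⇒cut (connected , acyclic) {a} {b} j with separate (λ x → reaches-end j (connected x a))
  ... | C , C⊆ , ∁C⊆ = record
    { C      = C
    ; a∈C    = in-C λ a∉C → no-detour (∁C⊆ a∉C)
    ; b∉C    = λ b∈C → no-detour (reverse G−e.sym (C⊆ b∈C))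
    ; closed = λ {x} {y} x~y x∈C → in-C λ y∉C →
        no-detour (reverse G−e.sym (C⊆ x∈C) ◅◅ x~y ◅ ∁C⊆ y∉C)
    }
    where
    no-detour : ¬ Star G−e._~_ a b
    no-detour = acyclic ∘ detour⇒cycle j
    in-C : ∀ {x} → ¬ x ∉ C → x ∈ C
    in-C {x} = decidable-stable (x ∈? C)

  -- With only two possible values for each number, they differ in just two ways: one makes `e`
  -- weak, the other strong.
  ¬weak∧¬strong⇒γ≡ : IsTree G → ¬ Weak e → ¬ Strong e → γ G−e ≡ γ Gₑ
  ¬weak∧¬strong⇒γ≡ tree ¬weak ¬strong with γ G−e ≤? γ G | γ Gₑ ≤? γ G
  ... | yes p | yes q = ≤-antisym (≤-trans p γ≤γ-subdivide) (≤-trans q γ≤γ-delete)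
  ... | yes p | no ¬q = contradiction (≤γ⇒weak (tree⇒cut tree) p ¬q) ¬weak
  ... | no ¬p | yes q = contradiction (≤γ⇒strong ¬p q) ¬strong
  ... | no ¬p | no ¬q =
    ≤-antisym (≤-trans γ-delete≤1+γ (≰⇒> ¬q)) (≤-trans γ-subdivide≤1+γ (≰⇒> ¬p))

theorem8 : ∀ (n : ℕ) (T : Graph n) → IsTree T → 2 ≤ n →
    IsSR T ⇔ (¬ (∃ λ (e : Edge T) → Weak e) × ¬ (∃ λ (e : Edge T) → Strong e))
theorem8 n T tree 2≤n = mk⇔
  (λ (_ , _ , sr) →
    (λ (e , weak) → weak⇒γ-subdivide≰γ e weak
      (subst (_≤ γ T) (sr e) (weak⇒γ-delete≤γ e weak))) ,
    (λ (e , strong) → strong⇒γ-delete≰γ e strong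
      (subst (_≤ γ T) (sym (sr e)) (strong⇒γ-subdivide≤γ e strong))))
  (λ (¬weak , ¬strong) → proj₁ tree , 2≤n , λ e →
    ¬weak∧¬strong⇒γ≡ e tree (λ w → ¬weak (e , w)) (λ s → ¬strong (e , s)))
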